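{- For an infinite tournament $G\in\mathfrak{Out}_\infty$ the following are equivalent: (i) $G\notin\mathfrak{Out}_3$; (ii) $G\notin\mathfrak{Out}_n$ for each integer $n\ge 3$; (iii) there is a surjective homomorphism $\varphi:G\to\mathbb T_3$.
   Context: A tournament is a digraph $G=(V,E)$ such that for any two distinct $x,y\in V$ exactly one of $(x,y),(y,x)$ is in $E$. A set $A\subseteq V$ is independent if there is no edge (in either direction) between two distinct elements of $A$. For $n\in\mathbb N$ and $A\subseteq V$, $\mathrm{Out}^G_n(A)$ is the set of all $v\in V$ such that there is a directed path of length at most $n$ from some point of $A$ to $v$ (length $0$ allowed), and $\mathrm{Out}^G_\infty(A)=\bigcup_{n\in\mathbb N}\mathrm{Out}^G_n(A)$. For $n\in\mathbb N\cup\{\infty\}$, $G\in\mathfrak{Out}_n$ iff there is an independent set $A\subseteq V$ with $V=\mathrm{Out}^G_n(A)$. $\mathbb T_3$ is the digraph with vertex set $\mathbb N=\{0,1,2,\dots\}$ and edge set $\{(x,y):x\ge y\}\cup\{(x,x+1):x\in\mathbb N\}$ (loops included). A homomorphism of digraphs is a map of vertex sets sending edges to edges. -}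

module Defs where

open import Level using (Level; 0ℓ; suc; _⊔_)
open import Data.Fin.Base using (Fin)
open import Data.List.Base using (List; head; last; length)
open import Data.List.Relation.Unary.Linked using (Linked)
open import Data.List.Relation.Unary.Unique.Propositional using (Unique)
open import Data.Maybe.Base using (just)
open import Data.Nat.Base as ℕ using (ℕ; _≤_; _≥_)
open import Data.Product.Base using (∃-syntax; _×_)
open import Data.Sum.Base using (_⊎_)
open import Function.Bundles using (_↔_)
open import Relation.Binary.Core using (Rel)
open import Relation.Binary.Morphism.Definitions using (Homomorphic₂)
open import Relation.Binary.PropositionalEquality.Core using (_≡_; _≢_)
open import Relation.Nullary.Negation.Core using (¬_)
open import Relation.Unary using (Pred; _∈_; ⋃; Universal)

private
  variable
    ℓ ℓ₁ ℓ₂ : Level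

Finite : Set ℓ → Set ℓ
Finite A = ∃[ n ] (A ↔ Fin n)

Infinite : Set ℓ → Set ℓ
Infinite A = ¬ Finite A

-- Vertices are compared by propositional equality.  Loops are allowed.
record Digraph (ℓ : Level) : Set (suc ℓ) where
  field
    V : Set ℓ
    E : Rel V ℓ

open Digraph public

Tournament : Digraph ℓ → Set ℓ
Tournament G = ∀ (x y : V G) → x ≢ y →
  (E G x y × ¬ E G y x) ⊎ (¬ E G x y × E G y x)

Independent : (G : Digraph ℓ) → Pred (V G) ℓ → Set ℓ
Independent G A = ∀ {x y} → x ∈ A → y ∈ A → x ≢ y → ¬ E G x y × ¬ E G y x

-- The length of a path is its number of edges; its vertices are pairwise
-- distinct.
record DirectedPath (G : Digraph ℓ) (x y : V G) (n : ℕ) : Set ℓ where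
  field
    vertices   : List (V G)
    starts     : head vertices ≡ just x
    ends       : last vertices ≡ just y
    has-length : length vertices ≡ ℕ.suc n
    edges      : Linked (E G) vertices
    distinct   : Unique vertices

Out : (G : Digraph ℓ) → ℕ → Pred (V G) ℓ → Pred (V G) ℓ
Out G n A v = ∃[ a ] (a ∈ A × ∃[ k ] (k ≤ n × DirectedPath G a v k))

Out∞ : (G : Digraph ℓ) → Pred (V G) ℓ → Pred (V G) ℓ
Out∞ G A = ⋃ ℕ λ n → Out G n A

-- The classes 𝔒ut n and 𝔒ut∞; membership of G is written  G ∈ 𝔒ut n.
𝔒ut : ℕ → Pred (Digraph ℓ) (suc ℓ)
𝔒ut {ℓ} n G = ∃[ A ] (Independent {ℓ} G A × Universal (Out G n A))

𝔒ut∞ : Pred (Digraph ℓ) (suc ℓ)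
𝔒ut∞ {ℓ} G = ∃[ A ] (Independent {ℓ} G A × Universal (Out∞ G A))

𝕋₃ : Digraph 0ℓ
𝕋₃ = record
  { V = ℕ
  ; E = λ x y → x ≥ y ⊎ y ≡ ℕ.suc x
  }

IsHomomorphism : (G : Digraph ℓ₁) (H : Digraph ℓ₂) → (V G → V H) → Set (ℓ₁ ⊔ ℓ₂)
IsHomomorphism G H φ = Homomorphic₂ (V G) (V H) (E G) (E H) φ

{-# OPTIONS --safe #-}
-- In a tournament an independent set has at most one element, so membership in
-- 𝔒ut n means that some root r has eccentricity at most n.  Let dist be the
-- distance from a root r.  An edge raises dist by at most one, hence a vertex
-- dominates every vertex lying at least two levels below it.
-- If dist has a maximum m + 2, a vertex y at that level dominates all levels up
-- to m, and so reaches levels m + 1 and m + 2 in two and three steps: y has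
-- eccentricity at most 3.  If dist is unbounded, it is the homomorphism onto 𝕋₃.
-- Conversely, a homomorphism to 𝕋₃ grows by at most one along an edge, so it is
-- bounded when some root has finite eccentricity.
module Submission where

open import Defs
open import Level using (Level)
open import Axiom.ExcludedMiddle using (ExcludedMiddle)
open import Data.List.Base using (List; []; _∷_; head; last; length)
open import Data.List.Membership.Propositional using () renaming (_∈_ to _∈ᴸ_)
open import Data.List.Relation.Unary.All using ([])
open import Data.List.Relation.Unary.All.Properties using (¬Any⇒All¬)
open import Data.List.Relation.Unary.AllPairs using ([]; _∷_)
open import Data.List.Relation.Unary.Any using (here; there)
open import Data.List.Relation.Unary.Linked using (Linked; [-]; _∷_)
open import Data.List.Relation.Unary.Unique.Propositional using (Unique)
open import Data.Maybe.Base using (just)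
open import Data.Nat.Base using (ℕ; zero; suc; _+_; _≤_; _<_; _≥_; z≤n; s≤s; s≤s⁻¹)
open import Data.Nat.Induction using (<-rec)
open import Data.Nat.Properties
open import Data.Product.Base using (∃-syntax; _×_; _,_; proj₁; proj₂)
open import Data.Sum.Base using (inj₁; inj₂)
open import Function.Base using (_∘_)
open import Function.Bundles using (_⇔_; mk⇔; mk↔ₛ′)
open import Function.Definitions using (Surjective)
open import Relation.Binary.PropositionalEquality.Core
  using (_≡_; refl; sym; subst)
open import Relation.Nullary.Decidable.Core using (yes; no)
open import Relation.Nullary.Negation.Core using (¬_; contradiction)
open import Relation.Unary using (Pred; Decidable; _∈_; _∉_; ｛_｝)

private
  variable
    ℓ : Level

least : {P : Pred ℕ ℓ} → Decidable P → ∀ {n} → P n →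
        ∃[ m ] (P m × (∀ {k} → P k → m ≤ k))
least {P = P} P? {n} = <-rec (λ n → P n → ∃[ m ] (P m × (∀ {k} → P k → m ≤ k))) step n
  where
  step : ∀ n → (∀ {k} → k < n → P k → ∃[ m ] (P m × (∀ {k} → P k → m ≤ k))) →
         P n → ∃[ m ] (P m × (∀ {k} → P k → m ≤ k))
  step n rec pn with anyUpTo? P? n
  ... | yes (k , k<n , pk) = rec k<n pk
  ... | no none = n , pn , λ {k} pk → ≮⇒≥ λ k<n → none (k , k<n , pk)

-- Vertices may repeat, so extending a walk by an edge needs no check of distinctness. Growth at the
-- target end suits induction on distance from a fixed root.
data Walk (G : Digraph ℓ) (x : V G) : ℕ → V G → Set ℓ where
  stop : Walk G x 0 x
  _▷_  : ∀ {n u v} → Walk G x n u → E G u v → Walk G x (suc n) v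

module _ {G : Digraph ℓ} where

  prepend : ∀ {w x n v} → E G w x → Walk G x n v → Walk G w (suc n) v
  prepend e stop     = stop ▷ e
  prepend e (p ▷ e′) = prepend e p ▷ e′

  path⇒walk : ∀ {x v n} → DirectedPath G x v n → Walk G x n v
  path⇒walk p = go (vertices p) (starts p) (ends p) (has-length p) (edges p)
    where
    open DirectedPath
    go : ∀ {x v n} (xs : List (V G)) → head xs ≡ just x → last xs ≡ just v →
         length xs ≡ suc n → Linked (E G) xs → Walk G x n v
    go (_ ∷ [])    refl refl refl _       = stop
    go (_ ∷ _ ∷ _) refl eq   refl (e ∷ l) = prepend e (go _ refl eq refl l)

  walk-bound : ∀ {φ} → IsHomomorphism G 𝕋₃ φ →
               ∀ {x n v} → Walk G x n v → φ v ≤ n + φ x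
  walk-bound h stop = ≤-refl
  walk-bound h (p ▷ e) with h e
  ... | inj₁ v≤u = ≤-trans v≤u (m≤n⇒m≤1+n (walk-bound h p))
  ... | inj₂ v≡1+u = ≤-trans (≤-reflexive v≡1+u) (s≤s (walk-bound h p))

module Classical (em : ExcludedMiddle ℓ) (G : Digraph ℓ) where

  -- The suffix starting at `w` is again a path. It serves to cut off the cycle that a new first
  -- vertex may create.
  path-from : ∀ {w v} (xs : List (V G)) → w ∈ᴸ xs → last xs ≡ just v →
              Linked (E G) xs → Unique xs →
              ∃[ k ] (suc k ≤ length xs × DirectedPath G w v k)
  path-from (x ∷ xs) (here refl) eq l u = length xs , ≤-refl , record
    { vertices = x ∷ xs ; starts = refl ; ends = eq ; has-length = refl
    ; edges = l ; distinct = u }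
  path-from (_ ∷ y ∷ xs) (there w∈) eq (_ ∷ l) (_ ∷ u) =
    let k , k< , p = path-from (y ∷ xs) w∈ eq l u in k , m≤n⇒m≤1+n k< , p

  prepend-path : ∀ {w x v n} → E G w x → DirectedPath G x v n →
                 ∃[ k ] (k ≤ suc n × DirectedPath G w v k)
  prepend-path {w} e record { vertices = x ∷ xs ; starts = refl ; ends = eq
                            ; has-length = refl ; edges = l ; distinct = u }
    -- If `w` already lies on the path, the suffix from `w` replaces the whole path and the edge `e`
    -- is dropped.
    with em {w ∈ᴸ x ∷ xs}
  ... | yes w∈ = let k , k< , p = path-from (x ∷ xs) w∈ eq l u in
                 k , m≤n⇒m≤1+n (s≤s⁻¹ k<) , p
  ... | no w∉ = _ , ≤-refl , record
    { vertices = w ∷ x ∷ xs ; starts = refl ; ends = eq ; has-length = refl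
    ; edges = e ∷ l ; distinct = ¬Any⇒All¬ _ w∉ ∷ u }

  walk⇒path : ∀ {x n v} → Walk G x n v → ∃[ k ] (k ≤ n × DirectedPath G x v k)
  walk⇒path {x} {n} {v} p =
    let k , k≤ , q = go p trivial in k , ≤-trans k≤ (≤-reflexive (+-identityʳ n)) , q
    where
    trivial : DirectedPath G v v 0
    trivial = record
      { vertices = v ∷ [] ; starts = refl ; ends = refl ; has-length = refl
      ; edges = [-] ; distinct = [] ∷ [] }

    -- The walk is consumed from its last edge backwards, while `q` is the path built so far from
    -- the current vertex to `v`.
    go : ∀ {m u j} → Walk G x m u → DirectedPath G u v j →
         ∃[ k ] (k ≤ m + j × DirectedPath G x v k)
    go stop q = _ , ≤-refl , q
    go {suc m} {j = j} (p ▷ e) q =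
      let i , i≤ , q′ = prepend-path e q
          k , k≤ , q″ = go p q′
      in k , ≤-trans k≤ (≤-trans (+-monoʳ-≤ m i≤) (≤-reflexive (+-suc m j))) , q″

  root⇒𝔒ut : ∀ {n} r → (∀ v → ∃[ k ] (k ≤ n × Walk G r k v)) → G ∈ 𝔒ut n
  root⇒𝔒ut r walks = ｛ r ｝ , (λ { refl refl r≢r → contradiction refl r≢r }) , λ v →
    let k , k≤n , p = walks v
        j , j≤k , q = walk⇒path p
    in r , refl , j , ≤-trans j≤k k≤n , q

  inhabited : Infinite (V G) → V G
  inhabited inf with em {V G}
  ... | yes v = v
  -- An empty vertex set would be in bijection with `Fin 0`.
  ... | no empty = contradiction
    (0 , mk↔ₛ′ (λ v → contradiction v empty) (λ ()) (λ ()) (λ v → contradiction v empty)) inf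

module Rooted (em : ExcludedMiddle ℓ) (G : Digraph ℓ) (tour : Tournament G)
              (r : V G) (reach : ∀ v → ∃[ k ] Walk G r k v) where

  open Classical em G

  private
    shortest : ∀ v → ∃[ m ] (Walk G r m v × (∀ {k} → Walk G r k v → m ≤ k))
    shortest v = least (λ _ → em) (proj₂ (reach v))

  dist : V G → ℕ
  dist v = proj₁ (shortest v)

  geodesic : ∀ v → Walk G r (dist v) v
  geodesic v = proj₁ (proj₂ (shortest v))

  dist-minimal : ∀ {v k} → Walk G r k v → dist v ≤ k
  dist-minimal {v} = proj₂ (proj₂ (shortest v))

  dist-edge : ∀ {u v} → E G u v → dist v ≤ suc (dist u)
  dist-edge e = dist-minimal (geodesic _ ▷ e)

  dist-homomorphism : IsHomomorphism G 𝕋₃ dist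
  dist-homomorphism e with m≤n⇒m<n∨m≡n (dist-edge e)
  ... | inj₁ v<1+u = inj₁ (s≤s⁻¹ v<1+u)
  ... | inj₂ v≡1+u = inj₂ v≡1+u

  back-edge : ∀ {u v} → suc (dist u) < dist v → E G v u
  back-edge {u} {v} u≪v with tour u v (λ { refl → <⇒≱ u≪v (n≤1+n _) })
  ... | inj₁ (e , _) = contradiction (dist-edge e) (<⇒≱ u≪v)
  ... | inj₂ (_ , e) = e

  -- The last edge of a geodesic starts one level down: the truncated geodesic bounds `dist u` from
  -- above, the edge bounds it from below.
  predecessor : ∀ {v n} → dist v ≡ suc n → ∃[ u ] (E G u v × dist u ≡ n)
  predecessor {v} eq with subst (λ m → Walk G r m v) eq (geodesic v)
  ... | _▷_ {u = u} p e =
    u , e , ≤-antisym (dist-minimal p) (s≤s⁻¹ (≤-trans (≤-reflexive (sym eq)) (dist-edge e)))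

  -- Stepping back through predecessors skips no level.
  level-below : ∀ {n} m {v} → dist v ≡ m → n ≤ m → ∃[ u ] dist u ≡ n
  level-below m eq n≤m with m≤n⇒m<n∨m≡n n≤m
  ... | inj₂ refl = _ , eq
  level-below (suc m) eq _ | inj₁ n<1+m =
    let u , _ , eq′ = predecessor eq in level-below m eq′ (s≤s⁻¹ n<1+m)

  -- Levels up to `m` cost one back edge from `y`; each further level costs one more edge, entered
  -- through a predecessor.
  descend-then-climb : ∀ {m y} → dist y ≡ 2 + m → ∀ k {v} → dist v ≤ k + m →
                       ∃[ j ] (j ≤ suc k × Walk G y j v)
  descend-then-climb eq zero v≤m =
    1 , ≤-refl , stop ▷ back-edge (≤-trans (s≤s (s≤s v≤m)) (≤-reflexive (sym eq)))
  descend-then-climb eq (suc k) v≤ with m≤n⇒m<n∨m≡n v≤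
  ... | inj₁ v< = let j , j≤ , p = descend-then-climb eq k (s≤s⁻¹ v<) in j , m≤n⇒m≤1+n j≤ , p
  ... | inj₂ v≡ =
    let u , e , u≡ = predecessor v≡
        j , j≤ , p = descend-then-climb eq k (≤-reflexive u≡)
    in suc j , s≤s j≤ , p ▷ e

  dist-bounded⇒𝔒ut : ∀ {n} → (∀ v → dist v ≤ n) → G ∈ 𝔒ut n
  dist-bounded⇒𝔒ut bound = root⇒𝔒ut r λ v → dist v , bound v , geodesic v

  -- The bound is lowered until it is attained. A maximum of at most 1 lets `r` itself serve as
  -- root; otherwise a vertex of maximal level replaces it.
  dist-bounded⇒𝔒ut3 : ∀ n → (∀ v → dist v ≤ n) → G ∈ 𝔒ut 3
  dist-bounded⇒𝔒ut3 zero bound = dist-bounded⇒𝔒ut λ v → ≤-trans (bound v) z≤n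
  dist-bounded⇒𝔒ut3 (suc n) bound with em {∃[ y ] dist y ≡ suc n}
  ... | no none = dist-bounded⇒𝔒ut3 n λ v → s≤s⁻¹ (≤∧≢⇒< (bound v) λ eq → none (v , eq))
  dist-bounded⇒𝔒ut3 (suc zero) bound | yes _ =
    dist-bounded⇒𝔒ut λ v → ≤-trans (bound v) (s≤s z≤n)
  dist-bounded⇒𝔒ut3 (suc (suc m)) bound | yes (y , eq) =
    -- All levels are at most `2 + m`, so `k = 2` covers every vertex with walks of length at most
    -- 3.
    root⇒𝔒ut y λ v → descend-then-climb eq 2 (bound v)

  dist-surjective : (∀ n → ¬ (∀ v → dist v ≤ n)) → Surjective _≡_ _≡_ dist
  dist-surjective unbounded n with em {∃[ v ] n < dist v}
  ... | no none = contradiction (λ v → ≮⇒≥ λ n<v → none (v , n<v)) (unbounded n)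
  ... | yes (v , n<v) =
    let u , eq = level-below (dist v) refl (<⇒≤ n<v) in u , λ { refl → eq }

  ∉𝔒ut3⇒dist-surjection : G ∉ 𝔒ut 3 → ∃[ φ ] (IsHomomorphism G 𝕋₃ φ × Surjective _≡_ _≡_ φ)
  ∉𝔒ut3⇒dist-surjection G∉ =
    dist , dist-homomorphism , dist-surjective λ n → G∉ ∘ dist-bounded⇒𝔒ut3 n

module _ (em : ExcludedMiddle ℓ) (G : Digraph ℓ) (inf : Infinite (V G)) (tour : Tournament G) where

  open Classical em G

  independent-unique : ∀ {A} → Independent G A → ∀ {a b} → a ∈ A → b ∈ A → a ≡ b
  independent-unique ind {a} {b} a∈ b∈ with em {a ≡ b}
  ... | yes eq = eq
  ... | no a≢b with tour a b a≢b
  ... | inj₁ (e , _) = contradiction e (proj₁ (ind a∈ b∈ a≢b))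
  ... | inj₂ (_ , e) = contradiction e (proj₂ (ind a∈ b∈ a≢b))

  𝔒ut∞⇒root : G ∈ 𝔒ut∞ → ∃[ r ] (∀ v → ∃[ k ] Walk G r k v)
  𝔒ut∞⇒root (A , ind , out) =
    -- Reaching one arbitrary vertex yields a member `r` of `A`; every other starting point then
    -- equals `r`.
    let _ , r , r∈ , _ = out (inhabited inf)
    in r , λ v → let _ , a , a∈ , k , _ , p = out v in
       k , subst (λ x → Walk G x k v) (independent-unique ind a∈ r∈) (path⇒walk p)

  𝔒ut⇒root : ∀ {n} → G ∈ 𝔒ut n → ∃[ r ] (∀ v → ∃[ k ] (k ≤ n × Walk G r k v))
  𝔒ut⇒root (A , ind , out) =
    let r , r∈ , _ = out (inhabited inf)
    in r , λ v → let a , a∈ , k , k≤n , p = out v in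
       k , k≤n , subst (λ x → Walk G x k v) (independent-unique ind a∈ r∈) (path⇒walk p)

  𝔒ut⇒𝔒ut3 : ∀ {n} → G ∈ 𝔒ut n → G ∈ 𝔒ut 3
  𝔒ut⇒𝔒ut3 {n} G∈ =
    let r , walks = 𝔒ut⇒root G∈
        reach = λ v → let k , _ , p = walks v in k , p
    in Rooted.dist-bounded⇒𝔒ut3 em G tour r reach n λ v →
       let _ , k≤n , p = walks v in ≤-trans (Rooted.dist-minimal em G tour r reach p) k≤n

  ∉𝔒ut3⇒surjection : G ∈ 𝔒ut∞ → G ∉ 𝔒ut 3 →
                     ∃[ φ ] (IsHomomorphism G 𝕋₃ φ × Surjective _≡_ _≡_ φ)
  ∉𝔒ut3⇒surjection G∈ =
    let r , reach = 𝔒ut∞⇒root G∈ in Rooted.∉𝔒ut3⇒dist-surjection em G tour r reach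

  surjection⇒∉𝔒ut : ∃[ φ ] (IsHomomorphism G 𝕋₃ φ × Surjective _≡_ _≡_ φ) → ∀ n → G ∉ 𝔒ut n
  surjection⇒∉𝔒ut (φ , hom , surj) n G∈ =
    let r , walks = 𝔒ut⇒root G∈
        -- This value is one more than any that `φ` can take at the end of a walk of length at most
        -- `n` from `r`.
        v , eq = surj (suc (n + φ r))
        k , k≤n , p = walks v
    in <⇒≱ (≤-reflexive (sym (eq refl)))
           (≤-trans (walk-bound {G = G} {φ} hom p) (+-monoˡ-≤ (φ r) k≤n))

theorem4p2 : ∀ {ℓ} → ExcludedMiddle ℓ →
    (G : Digraph ℓ) → Infinite (V G) → Tournament G → G ∈ 𝔒ut∞ →
    (G ∉ 𝔒ut 3 ⇔ (∀ (n : ℕ) → n ≥ 3 → G ∉ 𝔒ut n))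
    × ((∀ (n : ℕ) → n ≥ 3 → G ∉ 𝔒ut n)
    ⇔ (∃[ φ ] (IsHomomorphism G 𝕋₃ φ × Surjective _≡_ _≡_ φ)))
theorem4p2 em G inf tour G∈ =
    mk⇔ (λ G∉ n _ → G∉ ∘ 𝔒ut⇒𝔒ut3 em G inf tour) (λ G∉ → G∉ 3 ≤-refl)
  , mk⇔ (λ G∉ → ∉𝔒ut3⇒surjection em G inf tour G∈ (G∉ 3 ≤-refl))
        (λ φ n _ → surjection⇒∉𝔒ut em G inf tour φ n)
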